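{- Let $\mathcal{A}$ be a union-closed family with base set $[n]$ and height $h$, and suppose $|\mathcal{A}|>1$. Then there exists an element of $[n]$ that is contained in at least $\frac{|\mathcal{A}|+h-3}{h-1}$ member sets of $\mathcal{A}$.
   Context: A family of sets $\mathcal{A}$ is union-closed if it is a finite family of distinct finite sets with at least one nonempty member set, and $X,Y\in\mathcal{A}$ implies $X\cup Y\in\mathcal{A}$ (the empty set may be a member). The base set $\bigcup_{A\in\mathcal{A}}A$ is denoted $[n]=\{1,\dots,n\}$. A chain in $\mathcal{A}$ is a subfamily any two distinct members of which are comparable under proper inclusion; the height $h$ of $\mathcal{A}$ is the maximum size of a chain in $\mathcal{A}$. -}

module Defs where

open import Data.Fin using (Fin)
open import Data.Fin.Properties using (¬∀⟶∃¬)
open import Data.Fin.Subset using (Subset; ⊤; _∈_; _∉_; _⊈_; _⊂_; _∪_; ⋃; Nonempty)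
open import Data.Fin.Subset.Properties using (_∈?_; _⊆?_; ⊆-antisym; ⊂-irref; p⊆p∪q; q⊆p∪q)
open import Data.List using (List; []; _∷_; length; filter)
open import Data.List.Membership.Propositional using () renaming (_∈_ to _∈ₗ_)
open import Data.List.Relation.Binary.Subset.Propositional using () renaming (_⊆_ to _⊆ₗ_)
open import Data.List.Relation.Unary.All using ([]; _∷_)
open import Data.List.Relation.Unary.AllPairs using ([]; _∷_)
open import Data.List.Relation.Unary.Any using (here; there)
open import Data.List.Relation.Unary.Unique.Propositional using (Unique)
open import Data.Nat using (ℕ; _≤_; _<_; _∸_; s≤s; NonZero; >-nonZero)
open import Data.Nat.Properties using (m<n⇒0<n∸m)
open import Data.Product using (∃; _×_; _,_)
open import Data.Sum using (_⊎_; inj₁; inj₂)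
open import Relation.Binary.PropositionalEquality using (_≡_; _≢_; refl)
open import Relation.Nullary using (yes; no; contradiction)
open import Relation.Nullary.Decidable using (_→-dec_; decidable-stable)

private
  variable
    n h : ℕ

-- The base set [n] is Fin n. A finite family of sets is a list of subsets
-- without repetitions, so that its cardinality is the length of the list.
record IsUnionClosed {n : ℕ} (A : List (Subset n)) : Set where
  field
    distinct     : Unique A
    nonempty     : ∃ λ X → X ∈ₗ A × Nonempty X
    union-closed : ∀ {X Y} → X ∈ₗ A → Y ∈ₗ A → X ∪ Y ∈ₗ A

HasFullBase : List (Subset n) → Set
HasFullBase A = ⋃ A ≡ ⊤

record IsChain {n : ℕ} (A C : List (Subset n)) : Set where
  field
    distinct   : Unique C
    subfamily  : C ⊆ₗ A
    comparable : ∀ {X Y} → X ∈ₗ C → Y ∈ₗ C → X ≢ Y → X ⊂ Y ⊎ Y ⊂ X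

record IsHeight {n : ℕ} (A : List (Subset n)) (h : ℕ) : Set where
  field
    attained : ∃ λ C → IsChain A C × length C ≡ h
    maximal  : ∀ C → IsChain A C → length C ≤ h

degree : List (Subset n) → Fin n → ℕ
degree A x = length (filter (x ∈?_) A)

-- The remaining lemmas show that h - 1 is nonzero, so that it may be used as
-- a denominator.

⊈⇒∃ : {p q : Subset n} → p ⊈ q → ∃ λ x → x ∈ p × x ∉ q
⊈⇒∃ {n} {p} {q} p⊈q
  with ¬∀⟶∃¬ n (λ x → x ∈ p → x ∈ q) (λ x → (x ∈? p) →-dec (x ∈? q)) (λ f → p⊈q (λ {x} → f x))
... | x , ¬imp = x , decidable-stable (x ∈? p) (λ x∉p → ¬imp (λ x∈p → contradiction x∈p x∉p))
                   , (λ x∈q → ¬imp (λ _ → x∈q))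

pairChain : {A : List (Subset n)} {X Y : Subset n} → X ∈ₗ A → Y ∈ₗ A → X ⊂ Y → IsChain A (X ∷ Y ∷ [])
pairChain {X = X} {Y} X∈A Y∈A X⊂Y = record
  { distinct   = ((λ X≡Y → ⊂-irref X≡Y X⊂Y) ∷ []) ∷ [] ∷ []
  ; subfamily  = λ { (here refl) → X∈A ; (there (here refl)) → Y∈A }
  ; comparable = λ
      { (here refl)         (here refl)         X≢X → contradiction refl X≢X
      ; (here refl)         (there (here refl)) _   → inj₁ X⊂Y
      ; (there (here refl)) (here refl)         _   → inj₂ X⊂Y
      ; (there (here refl)) (there (here refl)) Y≢Y → contradiction refl Y≢Y
      }
  }

height>1 : {A : List (Subset n)} → IsUnionClosed A → IsHeight A h → 1 < length A → 1 < h
height>1 {A = []} uc ht ()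
height>1 {A = _ ∷ []} uc ht (s≤s ())
height>1 {A = X ∷ Y ∷ _} uc ht _ with IsUnionClosed.distinct uc | Y ⊆? X | X ⊆? Y
... | (X≢Y ∷ _) ∷ _ | yes Y⊆X | yes X⊆Y = contradiction (⊆-antisym X⊆Y Y⊆X) X≢Y
... | _ | no Y⊈X | _ with ⊈⇒∃ Y⊈X
...   | x , x∈Y , x∉X = IsHeight.maximal ht _
        (pairChain (here refl) (IsUnionClosed.union-closed uc (here refl) (there (here refl)))
          (p⊆p∪q Y , x , q⊆p∪q X Y x∈Y , x∉X))
height>1 {A = X ∷ Y ∷ _} uc ht _ | _ | yes _ | no X⊈Y with ⊈⇒∃ X⊈Y
...   | x , x∈X , x∉Y = IsHeight.maximal ht _
        (pairChain (there (here refl)) (IsUnionClosed.union-closed uc (here refl) (there (here refl)))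
          (q⊆p∪q X Y , x , p⊆p∪q Y x∈X , x∉Y))

height-1-nonZero : {A : List (Subset n)} → IsUnionClosed A → IsHeight A h → 1 < length A → NonZero (h ∸ 1)
height-1-nonZero uc ht 1<∣A∣ = >-nonZero (m<n⇒0<n∸m (height>1 uc ht 1<∣A∣))

{-# OPTIONS --safe #-}

-- Start from the whole family. While at least two members remain, pick an
-- element x of one remaining member that is missing from another, and keep only
-- the members avoiding x. The unions of the successive families are members of A
-- and form a strictly decreasing chain, so there are k ≤ h - 1 steps before a
-- single member is left. If d is the maximum degree, each step discards at most
-- d members, and every step but the first at most d - 1, because the full base
-- set is a member and is discarded in the first step. Hence
-- |A| ≤ 1 + d + (k - 1)(d - 1) ≤ 2 + (h - 1)(d - 1).

module Submission where

open import Defs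
open import Data.Fin using (Fin)
open import Data.Fin.Subset using (Subset; ⊤; _∪_; ⋃) renaming (_∈_ to _∈ₛ_; _∉_ to _∉ₛ_; _⊆_ to _⊆ₛ_; _⊂_ to _⊂ₛ_)
open import Data.Fin.Subset.Properties using (_∈?_; _⊆?_; ⊆-antisym; ⊂-irref; p⊆p∪q; q⊆p∪q; x∈p∪q⁻; ∪-identityʳ; ∈⊤)
open import Data.Integer using (+_; _+_; _-_)
import Data.Integer as ℤ
import Data.Integer.Properties as ℤ
open import Data.List using (List; length; []; _∷_; filter; allFin)
open import Data.List.Extrema.Nat using (argmax; f[xs]≤f[argmax])
open import Data.List.Membership.Propositional using (_∈_; lose)
open import Data.List.Membership.Propositional.Properties using (∈-filter⁺; ∈-filter⁻; ∈-allFin; ∈-length)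
open import Data.List.Properties using (length-filter; filter-notAll; filter-some; filter-accept; filter-reject)
open import Data.List.Relation.Binary.Subset.Propositional using (_⊆_)
open import Data.List.Relation.Binary.Subset.Propositional.Properties using (filter-⊆)
import Data.List.Relation.Unary.All as All
open import Data.List.Relation.Unary.AllPairs using ([]; _∷_)
open import Data.List.Relation.Unary.Any using (here; there)
open import Data.List.Relation.Unary.Unique.Propositional using (Unique)
import Data.List.Relation.Unary.Unique.Propositional.Properties as Unique
open import Data.Nat using (ℕ; _<_; _∸_; zero; suc; z≤n; s≤s; NonZero)
import Data.Nat as ℕ
open import Data.Nat.Induction using (<-wellFounded)
import Data.Nat.Properties as ℕ
open import Data.Nat.Tactic.RingSolver using (solve-∀)
open import Data.Product using (∃; ∃₂; _×_; _,_; proj₁; proj₂)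
open import Data.Rational.Unnormalised using (_/_; _≤_; *≤*)
open import Data.Sum using (inj₁; inj₂; [_,_]′)
open import Function using (_∘_)
open import Induction.WellFounded using (Acc; acc)
open import Level using (Level)
open import Relation.Binary.PropositionalEquality using (_≡_; refl; sym; trans; cong; subst)
open import Relation.Nullary using (yes; no; contradiction)
open import Relation.Unary using (Pred; Decidable)
open import Relation.Unary.Properties using (∁?)

private
  variable
    a p q : Level
    n h e : ℕ

module _ {X : Set a} {P : Pred X p} (P? : Decidable P) where

  length-filter+∁ : ∀ xs → length xs ≡ length (filter P? xs) ℕ.+ length (filter (∁? P?) xs)
  length-filter+∁ [] = refl
  length-filter+∁ (x ∷ xs) with P? x
  ... | yes _ = cong suc (length-filter+∁ xs)
  ... | no _  = trans (cong suc (length-filter+∁ xs)) (sym (ℕ.+-suc _ _))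

  -- This makes a degree in `avoiding x B` the length of a filtered list of the members containing
  -- `y`, to which the library bounds on `filter` apply.
  filter-comm : {Q : Pred X q} (Q? : Decidable Q) → ∀ xs →
                filter P? (filter Q? xs) ≡ filter Q? (filter P? xs)
  filter-comm Q? [] = refl
  filter-comm Q? (x ∷ xs) with P? x | Q? x
  ... | yes Px | yes Qx = trans (filter-accept P? Px) (trans (cong (x ∷_) (filter-comm Q? xs)) (sym (filter-accept Q? Qx)))
  ... | yes Px | no ¬Qx = trans (filter-comm Q? xs) (sym (filter-reject Q? ¬Qx))
  ... | no ¬Px | yes Qx = trans (filter-reject P? ¬Px) (filter-comm Q? xs)
  ... | no ¬Px | no ¬Qx = filter-comm Q? xs

maximiser : (f : Fin n → ℕ) → Fin n → ∃ λ x → ∀ y → f y ℕ.≤ f x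
maximiser {n} f x₀ = argmax f x₀ (allFin n) ,
  λ y → All.lookup (f[xs]≤f[argmax] {f = f} x₀ (allFin n)) (∈-allFin y)

UnionClosed : List (Subset n) → Set
UnionClosed B = ∀ {X Y} → X ∈ B → Y ∈ B → X ∪ Y ∈ B

∈⇒⊆⋃ : {B : List (Subset n)} {X : Subset n} → X ∈ B → X ⊆ₛ ⋃ B
∈⇒⊆⋃ {B = _ ∷ B} (here refl)  = p⊆p∪q (⋃ B)
∈⇒⊆⋃ {B = Z ∷ B} (there X∈B) = q⊆p∪q Z (⋃ B) ∘ ∈⇒⊆⋃ X∈B

-- Induction on `C` with `B` fixed, so that closure of `B` applies throughout. It stops at one
-- member, since the empty union may lie outside `B`.
⋃-closed : {B : List (Subset n)} → UnionClosed B → ∀ C → C ⊆ B → 0 < length C → ⋃ C ∈ B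
⋃-closed uc (X ∷ [])      C⊆B _ = subst (_∈ _) (sym (∪-identityʳ X)) (C⊆B (here refl))
⋃-closed uc (X ∷ C@(_ ∷ _)) C⊆B _ = uc (C⊆B (here refl)) (⋃-closed uc C (C⊆B ∘ there) (s≤s z≤n))

-- Distinct sets cannot include each other both ways. In a discarding step `x` makes the union
-- shrink strictly, and `Y` survives.
separated : (B : List (Subset n)) → Unique B → 1 < length B →
            ∃₂ λ x Y → Y ∈ B × x ∈ₛ ⋃ B × x ∉ₛ Y
separated (_ ∷ []) _ (s≤s ())
separated (X ∷ Y ∷ B) ((X≢Y All.∷ _) ∷ _) _ with X ⊆? Y | Y ⊆? X
... | yes X⊆Y | yes Y⊆X = contradiction (⊆-antisym X⊆Y Y⊆X) X≢Y
... | no X⊈Y | _ with ⊈⇒∃ X⊈Y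
...   | x , x∈X , x∉Y = x , Y , there (here refl) , ∈⇒⊆⋃ {B = X ∷ Y ∷ B} (here refl) x∈X , x∉Y
separated (X ∷ Y ∷ B) _ _ | yes _ | no Y⊈X with ⊈⇒∃ Y⊈X
... | x , x∈Y , x∉X = x , X , here refl , ∈⇒⊆⋃ {B = X ∷ Y ∷ B} (there (here refl)) x∈Y , x∉X

consChain : {B C : List (Subset n)} {U : Subset n} →
            U ∈ B → IsChain B C → (∀ {Y} → Y ∈ C → Y ⊂ₛ U) → IsChain B (U ∷ C)
consChain U∈B ch C⊂U = record
  { distinct   = All.tabulate (λ Y∈C U≡Y → ⊂-irref (sym U≡Y) (C⊂U Y∈C)) ∷ IsChain.distinct ch
  ; subfamily  = λ { (here refl) → U∈B ; (there Y∈C) → IsChain.subfamily ch Y∈C }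
  ; comparable = λ
      { (here refl)  (here refl)  U≢U → contradiction refl U≢U
      ; (here refl)  (there Y∈C) _   → inj₂ (C⊂U Y∈C)
      ; (there X∈C) (here refl)  _   → inj₁ (C⊂U X∈C)
      ; (there X∈C) (there Y∈C) X≢Y → IsChain.comparable ch X∈C Y∈C X≢Y
      }
  }

singletonChain : (X : Subset n) → IsChain (X ∷ []) (X ∷ [])
singletonChain X = record
  { distinct   = All.[] ∷ []
  ; subfamily  = λ X∈ → X∈
  ; comparable = λ { (here refl) (here refl) X≢X → contradiction refl X≢X }
  }

avoiding : Fin n → List (Subset n) → List (Subset n)
avoiding x = filter (∁? (x ∈?_))

∈-avoiding⁺ : {x : Fin n} {B : List (Subset n)} {X : Subset n} → X ∈ B → x ∉ₛ X → X ∈ avoiding x B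
∈-avoiding⁺ {x = x} = ∈-filter⁺ (∁? (x ∈?_))

∈-avoiding⁻ : {x : Fin n} {B : List (Subset n)} {X : Subset n} → X ∈ avoiding x B → X ∈ B × x ∉ₛ X
∈-avoiding⁻ {x = x} = ∈-filter⁻ (∁? (x ∈?_))

avoiding-closed : (x : Fin n) {B : List (Subset n)} → UnionClosed B → UnionClosed (avoiding x B)
avoiding-closed x uc {X} {Y} X∈ Y∈ with ∈-avoiding⁻ X∈ | ∈-avoiding⁻ Y∈
... | X∈B , x∉X | Y∈B , x∉Y = ∈-avoiding⁺ (uc X∈B Y∈B) ([ x∉X , x∉Y ]′ ∘ x∈p∪q⁻ X Y)

length-avoiding : (x : Fin n) (B : List (Subset n)) → length B ≡ degree B x ℕ.+ length (avoiding x B)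
length-avoiding x = length-filter+∁ (x ∈?_)

degree-avoiding-≤ : (x y : Fin n) (B : List (Subset n)) → degree (avoiding x B) y ℕ.≤ degree B y
degree-avoiding-≤ x y B rewrite filter-comm (y ∈?_) (∁? (x ∈?_)) B = length-filter (∁? (x ∈?_)) (filter (y ∈?_) B)

-- The set `U` counts towards the degree of `y` in `B` but is discarded for containing `x`.
degree-avoiding-< : (x y : Fin n) (B : List (Subset n)) {U : Subset n} → U ∈ B → x ∈ₛ U → y ∈ₛ U →
                    degree (avoiding x B) y < degree B y
degree-avoiding-< x y B U∈B x∈U y∈U rewrite filter-comm (y ∈?_) (∁? (x ∈?_)) B =
  filter-notAll (∁? (x ∈?_)) (filter (y ∈?_) B) (lose (∈-filter⁺ (y ∈?_) U∈B y∈U) (λ x∉U → x∉U x∈U))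

-- Members of `avoiding x B` lie inside `⋃ B` and miss its point `x`, so `⋃ B` fits strictly on top.
avoiding-chain : {B C : List (Subset n)} {x : Fin n} → UnionClosed B → 0 < length B → x ∈ₛ ⋃ B →
                 IsChain (avoiding x B) C → IsChain B (⋃ B ∷ C)
avoiding-chain {B = B} {x = x} uc 0<∣B∣ x∈⋃B ch = consChain (⋃-closed uc B (λ X∈ → X∈) 0<∣B∣)
  (record { distinct = IsChain.distinct ch
          ; subfamily = filter-⊆ (∁? (x ∈?_)) B ∘ IsChain.subfamily ch
          ; comparable = IsChain.comparable ch })
  (λ Y∈C → let Y∈B , x∉Y = ∈-avoiding⁻ {B = B} (IsChain.subfamily ch Y∈C)
           in ∈⇒⊆⋃ Y∈B , x , x∈⋃B , x∉Y)

-- Here `k` counts the discarding steps: each removes at most `e` members and adds one union to the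
-- chain, and a single member remains at the end.
long-chain : (B : List (Subset n)) → Acc _<_ (length B) → Unique B → UnionClosed B → 0 < length B →
             (∀ y → degree B y ℕ.≤ e) →
             ∃₂ λ k C → IsChain B C × length C ≡ suc k × length B ℕ.≤ suc (k ℕ.* e)
long-chain (X ∷ []) _ _ _ _ _ = 0 , X ∷ [] , singletonChain X , refl , s≤s z≤n
long-chain {e = e} B@(_ ∷ _ ∷ _) (acc rs) uniq uc 0<∣B∣ deg≤e
  with x , Y , Y∈B , x∈⋃B , x∉Y ← separated B uniq (s≤s (s≤s z≤n))
  with k , C , ch , ∣C∣≡1+k , ∣B′∣≤ ← long-chain (avoiding x B)
         -- The member `⋃ B` contains `x` and is discarded, so the length drops.
         (rs (filter-notAll (∁? (x ∈?_)) B (lose (⋃-closed uc B (λ X∈ → X∈) 0<∣B∣) (λ x∉ → x∉ x∈⋃B))))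
         (Unique.filter⁺ (∁? (x ∈?_)) uniq) (avoiding-closed x uc)
         (∈-length (∈-avoiding⁺ Y∈B x∉Y))
         (λ y → ℕ.≤-trans (degree-avoiding-≤ x y B) (deg≤e y))
  = suc k , ⋃ B ∷ C , avoiding-chain uc 0<∣B∣ x∈⋃B ch , cong suc ∣C∣≡1+k , (begin
      length B                             ≡⟨ length-avoiding x B ⟩
      degree B x ℕ.+ length (avoiding x B) ≤⟨ ℕ.+-mono-≤ (deg≤e x) ∣B′∣≤ ⟩
      e ℕ.+ suc (k ℕ.* e)                  ≡⟨ ℕ.+-suc e (k ℕ.* e) ⟩
      suc (suc k ℕ.* e)                    ∎)
  where open ℕ.≤-Reasoning

-- The theorem cleared of its denominator and subtraction of 3. The first step is separate from
-- `long-chain` because it is the one that discards `⊤`.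
size-bound : (A : List (Subset n)) → IsUnionClosed A → HasFullBase A → IsHeight A h → 1 < length A →
             ∀ d → (∀ y → degree A y ℕ.≤ d) → length A ℕ.+ h ℕ.≤ 3 ℕ.+ d ℕ.* (h ∸ 1)
size-bound {h = h} A uc full ht 1<∣A∣ d deg≤d = go d deg≤d h (IsHeight.maximal ht)
  where
  open IsUnionClosed uc
  open ℕ.≤-Reasoning

  0<∣A∣ : 0 < length A
  0<∣A∣ = ℕ.<-trans (s≤s z≤n) 1<∣A∣

  ⊤∈A : ⊤ ∈ A
  ⊤∈A = subst (_∈ A) full (⋃-closed union-closed A (λ X∈ → X∈) 0<∣A∣)

  identity : ∀ k e → suc e ℕ.+ suc (k ℕ.* e) ℕ.+ suc (suc k) ≡ 3 ℕ.+ suc e ℕ.* suc k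
  identity = solve-∀

  go : ∀ d → (∀ y → degree A y ℕ.≤ d) → ∀ h → (∀ C → IsChain A C → length C ℕ.≤ h) →
       length A ℕ.+ h ℕ.≤ 3 ℕ.+ d ℕ.* (h ∸ 1)
  go d deg≤d h maximal with separated A distinct 1<∣A∣
  -- The member `⊤` contains `x`, so degree bound 0 is impossible and `d - 1` makes sense.
  go zero deg≤d h maximal | x , _ =
    contradiction (ℕ.≤-trans (filter-some (x ∈?_) (lose ⊤∈A ∈⊤)) (deg≤d x)) λ ()
  go (suc e) deg≤d h maximal | x , Y , Y∈A , x∈⋃A , x∉Y
    -- With `⊤` discarded, every remaining degree is at most `e`, which is `d - 1`.
    with k , C , ch , ∣C∣≡1+k , ∣A′∣≤ ← long-chain {e = e} (avoiding x A) (<-wellFounded _)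
           (Unique.filter⁺ (∁? (x ∈?_)) distinct) (avoiding-closed x union-closed)
           (∈-length (∈-avoiding⁺ Y∈A x∉Y))
           (λ y → ℕ.≤-pred (ℕ.≤-trans (degree-avoiding-< x y A ⊤∈A ∈⊤ ∈⊤) (deg≤d y)))
    -- Putting `⋃ A` on top gives a chain of `k + 2` members, which forces `h = h′ + 2` with
    -- `k ≤ h′`.
    with h | subst (λ l → suc l ℕ.≤ h) ∣C∣≡1+k (maximal _ (avoiding-chain union-closed 0<∣A∣ x∈⋃A ch))
  ... | suc (suc h′) | s≤s (s≤s k≤h′) = begin
    length A ℕ.+ suc (suc h′)
      ≡⟨ cong (ℕ._+ suc (suc h′)) (length-avoiding x A) ⟩
    degree A x ℕ.+ length (avoiding x A) ℕ.+ suc (suc h′)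
      ≤⟨ ℕ.+-monoˡ-≤ (suc (suc h′)) (ℕ.+-mono-≤ (deg≤d x) (ℕ.≤-trans ∣A′∣≤ (s≤s (ℕ.*-monoˡ-≤ e k≤h′)))) ⟩
    suc e ℕ.+ suc (h′ ℕ.* e) ℕ.+ suc (suc h′)
      ≡⟨ identity h′ e ⟩
    3 ℕ.+ suc e ℕ.* suc h′ ∎

/-≤ : ∀ i d m .{{_ : NonZero m}} → i ℤ.≤ + d ℤ.* + m → i / m ≤ + d / 1
/-≤ i d (suc m) i≤dm = *≤* (subst (ℤ._≤ + d ℤ.* + suc m) (sym (ℤ.*-identityʳ i)) i≤dm)

-- Subtract 3 on both sides; the integer expressions then agree by computation.
-3-≤ : ∀ a b c → a ℕ.+ b ℕ.≤ 3 ℕ.+ c → + a + + b - + 3 ℤ.≤ + c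
-3-≤ a b c a+b≤3+c = ℤ.+-monoˡ-≤ (ℤ.- + 3) (ℤ.+≤+ a+b≤3+c)

theorem1p2 : ∀ (n h : ℕ) (A : List (Subset n)) (uc : IsUnionClosed A) → HasFullBase A →
    (ht : IsHeight A h) (1<∣A∣ : 1 < length A) →
    ∃ λ x → ((+ length A + + h - + 3) / (h ∸ 1)) {{height-1-nonZero uc ht 1<∣A∣}} ≤ + degree A x / 1
theorem1p2 n h A uc full ht 1<∣A∣
  -- The point from `separated` shows that `Fin n` is inhabited and starts the search for the
  -- maximum.
  with x , degree≤ ← maximiser (degree A) (proj₁ (separated A (IsUnionClosed.distinct uc) 1<∣A∣))
  = x , /-≤ _ d (h ∸ 1) {{height-1-nonZero uc ht 1<∣A∣}}
          (subst (+ length A + + h - + 3 ℤ.≤_) (ℤ.pos-* d (h ∸ 1))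
            (-3-≤ (length A) h (d ℕ.* (h ∸ 1)) (size-bound A uc full ht 1<∣A∣ d degree≤)))
  where d = degree A x
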